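{- Let $m,r,s$ be integers with $1\leq r,s\leq m-3$ and $r+s=m-2$. Then every strongly connected digraph $D$ with minimum semi-degree $\delta(D)=\min\{\delta^+(D),\delta^-(D)\}\geq m+1$ contains a subdigraph $T$ isomorphic to a member of $\{ODS(m;r,s),\ IDS(m;r,s),\ OIDS(m;r,s)\}$ such that $D-V(T)$ is strongly connected.
   Context: Digraphs are finite, without loops and without parallel arcs. A digraph is strongly connected if for every ordered pair of vertices $x,y$ there is a directed path from $x$ to $y$. $\delta^+(D)$, $\delta^-(D)$ are the minimum out-degree and minimum in-degree; $D-V(T)$ is the subdigraph induced by $V(D)\setminus V(T)$. For positive integers $r,s$ with $r+s=m-2$: the out-double-star $ODS(m;r,s)$ has vertices $u,v,a_1,\dots,a_r,b_1,\dots,b_s$ (all distinct) and arcs $(u,v)$, $(u,a_i)$ for all $i$, $(v,b_j)$ for all $j$ (two out-stars rooted at $u$ and $v$ joined by the arc $(u,v)$). The in-double-star $IDS(m;r,s)$ has the same vertices and arcs $(u,v)$, $(a_i,u)$, $(b_j,v)$. The out-in-double-star $OIDS(m;r,s)$ has the same vertices and arcs $(u,v)$, $(u,a_i)$, $(b_j,v)$. -}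

module Defs where

open import Data.Nat using (ℕ; _+_; _≤_)
open import Data.Bool using (Bool; true; false; if_then_else_)
open import Data.Fin using (Fin)
open import Data.List using (map; allFin)
open import Data.Nat.ListAction using (sum)
open import Data.Unit using (⊤)
open import Data.Product using (Σ; _×_)
open import Relation.Binary.PropositionalEquality using (_≡_)
open import Relation.Nullary using (¬_)

-- A finite digraph on vertex set Fin n, given by its (Boolean) arc relation.
-- Using a relation means there are no parallel arcs; looplessness is a hypothesis.
Adj : ℕ → Set
Adj n = Fin n → Fin n → Bool

Loopless : {n : ℕ} → Adj n → Set
Loopless {n} A = (x : Fin n) → A x x ≡ false

outdeg : {n : ℕ} → Adj n → Fin n → ℕ
outdeg {n} A x = sum (map (λ y → if A x y then 1 else 0) (allFin n))

indeg : {n : ℕ} → Adj n → Fin n → ℕ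
indeg {n} A x = sum (map (λ y → if A y x then 1 else 0) (allFin n))

MinSemiDegreeAtLeast : {n : ℕ} → Adj n → ℕ → Set
MinSemiDegreeAtLeast {n} A k = (x : Fin n) → (k ≤ outdeg A x) × (k ≤ indeg A x)

data WalkIn {n : ℕ} (A : Adj n) (S : Fin n → Set) : Fin n → Fin n → Set where
  here : {x : Fin n} → S x → WalkIn A S x x
  step : {x y z : Fin n} → S x → A x y ≡ true → WalkIn A S y z → WalkIn A S x z

StronglyConnectedOn : {n : ℕ} → Adj n → (Fin n → Set) → Set
StronglyConnectedOn {n} A S = (x y : Fin n) → S x → S y → WalkIn A S x y

StronglyConnected : {n : ℕ} → Adj n → Set
StronglyConnected A = StronglyConnectedOn A (λ _ → ⊤)

data DSV (r s : ℕ) : Set where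
  u : DSV r s
  v : DSV r s
  a : Fin r → DSV r s
  b : Fin s → DSV r s

data ODSArc {r s : ℕ} : DSV r s → DSV r s → Set where
  uv : ODSArc u v
  ua : (i : Fin r) → ODSArc u (a i)
  vb : (j : Fin s) → ODSArc v (b j)

data IDSArc {r s : ℕ} : DSV r s → DSV r s → Set where
  uv : IDSArc u v
  au : (i : Fin r) → IDSArc (a i) u
  bv : (j : Fin s) → IDSArc (b j) v

data OIDSArc {r s : ℕ} : DSV r s → DSV r s → Set where
  uv : OIDSArc u v
  ua : (i : Fin r) → OIDSArc u (a i)
  bv : (j : Fin s) → OIDSArc (b j) v

-- D contains a subdigraph T isomorphic to the pattern with arc relation Arc,
-- given by the embedding f (injective on vertices, arcs mapped to arcs);
-- V(T) is the image of f, and D - V(T) must be strongly connected.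
CopyWithSCComplement : {n r s : ℕ} → Adj n → (DSV r s → DSV r s → Set) → Set
CopyWithSCComplement {n} {r} {s} A Arc =
  Σ (DSV r s → Fin n) λ f →
    ((p q : DSV r s) → f p ≡ f q → p ≡ q) ×
    ((p q : DSV r s) → Arc p q → A (f p) (f q) ≡ true) ×
    StronglyConnectedOn A (λ x → (p : DSV r s) → ¬ (f p ≡ x))

{-# OPTIONS --safe #-}
module Submission where

-- Put m = r + s + 2. Keep a nonempty strong vertex set B and a double star T outside B.
-- Unless V(T) is the whole complement of B, take a shortest ear x₁ … x_k from B to B and find a
-- double star in the set Q of vertices outside both B and the ear; B plus the ear is again strong.
-- An arc of Q gives a double star once one end has m − 1 and the other m − 2 neighbours of a
-- fixed direction in Q, except when the tail counts only in-neighbours and the head only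
-- out-neighbours.
-- If k ≥ 2, no vertex outside B has arcs both from B and to B, so each has all its in-neighbours or
-- all its out-neighbours outside B; for k ≤ 2 this suffices (for k = 1, with vertices outside T).
-- If k ≥ 3, an out-neighbour w of x₁ in Q meets the ear in x₁, x₂, x₃ only. If no such w has m − 1
-- out-neighbours in Q, all are joined to x₃ and can replace x₂ in the ear, so that either some
-- choice produces a rich w or these at least m vertices form a complete digraph. An
-- out-neighbour x in Q of a rich w meets the ear in x₁, …, x₄ only, so the arc wx or xw works,
-- except for r = s = 1, where the ear is rerouted once more.

open import Defs
open import Data.Nat using (ℕ; zero; suc; _+_; _∸_; _≤_; _<_; z≤n; s≤s)
open import Data.Nat.Properties
  using (≤-refl; ≤-trans; ≤-reflexive; ≤-pred; <-irrefl; ≮⇒≥; n≤0⇒n≡0; n≤1+n; m≤n⇒m≤1+n;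
    m≤m+n; m≤n+m; suc-injective; +-comm; +-suc)
open import Data.Nat.Induction using (<-wellFounded)
open import Data.Nat.ListAction using (sum)
open import Data.Bool using (Bool; true; false; if_then_else_)
import Data.Bool.Properties as Bool
open import Data.Fin using (Fin; zero; suc; toℕ; fromℕ<)
open import Data.Fin.Properties using (_≟_; any?; toℕ<n; toℕ-fromℕ<)
open import Data.Fin.Subset using (Subset; ⁅_⁆; _∪_; _⊂_; _⊃_)
  renaming (_∈_ to _∈ˢ_; _∉_ to _∉ˢ_)
open import Data.Fin.Subset.Properties
  using (_∈?_; x∈⁅x⁆; x∈⁅y⁆⇒x≡y; x∈p∪q⁺; x∈p∪q⁻)
open import Data.Fin.Subset.Induction using (⊃-wellFounded)
open import Data.List using (List; []; _∷_; _++_; length; map; allFin; tabulate; foldr)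
open import Data.List.Properties using (length-++; length-tabulate)
open import Data.List.Relation.Unary.Any using (here; there)
import Data.List.Relation.Unary.All as All
open import Data.List.Relation.Unary.AllPairs using (_∷_)
open import Data.List.Relation.Unary.Unique.Propositional using (Unique)
open import Data.List.Relation.Unary.Unique.Propositional.Properties using (allFin⁺)
open import Data.List.Membership.Propositional using (_∈_; _∉_)
import Data.List.Membership.DecPropositional as DecMembership
open import Data.List.Membership.Propositional.Properties
  using (∈-++⁺ˡ; ∈-++⁺ʳ; ∈-++⁻; ∈-tabulate⁺; ∈-tabulate⁻)
open import Data.Product using (Σ; ∃; _×_; _,_; proj₁; proj₂)
open import Data.Sum using (_⊎_; inj₁; inj₂; [_,_]′)
open import Data.Empty using (⊥-elim)
open import Data.Unit using (⊤; tt)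
open import Function using (_∘_; id)
open import Induction.WellFounded using (Acc; acc)
open import Relation.Binary.PropositionalEquality
  using (_≡_; _≢_; refl; sym; trans; cong; cong₂; subst)
open import Relation.Nullary using (¬_; Dec; yes; no; ¬?)
open import Relation.Nullary.Decidable using (map′; _×-dec_; decidable-stable)

private
  variable
    n k j : ℕ

-- Lower bounds for the size of a set, by distinct witnesses

-- The nesting P, P ∖ x₁, P ∖ x₁ ∖ x₂, … makes deletion of an element structural and
-- needs no decidability of P.
data AtLeast {n : ℕ} (P : Fin n → Set) : ℕ → Set where
  none : AtLeast P 0
  pick : ∀ {k} x → P x → AtLeast (λ y → P y × y ≢ x) k → AtLeast P (suc k)

mapAtLeast : {P R : Fin n → Set} → (∀ {x} → P x → R x) → AtLeast P k → AtLeast R k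
mapAtLeast f none = none
mapAtLeast f (pick x px rest) =
  pick x (f px) (mapAtLeast (λ (py , y≢x) → f py , y≢x) rest)

weaken : {P : Fin n → Set} → j ≤ k → AtLeast P k → AtLeast P j
weaken z≤n c = none
weaken (s≤s j≤k) (pick x px rest) = pick x px (weaken j≤k rest)

member : {P : Fin n → Set} → AtLeast P (suc k) → ∃ P
member (pick x px _) = x , px

delete : {P : Fin n → Set} (z : Fin n) → AtLeast P (suc k) →
  AtLeast (λ y → P y × y ≢ z) k
delete {k = zero} z c = none
delete {k = suc k} z (pick x px rest) with x ≟ z
... | yes refl = rest
... | no x≢z = pick x (px , x≢z)
  (mapAtLeast (λ ((py , y≢x) , y≢z) → (py , y≢z) , y≢x) (delete z rest))

deleteAll : {P : Fin n → Set} (l : List (Fin n)) → AtLeast P (length l + k) →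
  AtLeast (λ y → P y × y ∉ l) k
deleteAll [] c = mapAtLeast (λ py → py , λ ()) c
deleteAll (z ∷ l) c = mapAtLeast
  (λ ((py , y≢z) , y∉l) → py , λ { (here y≡z) → y≢z y≡z ; (there y∈l) → y∉l y∈l })
  (deleteAll l (delete z c))

-- An entry of `l` outside `P` removes nothing, which saves one compared with `deleteAll`. Several
-- degree counts below depend on this unit.
deleteAllButOne : {P : Fin n → Set} {z : Fin n} (l : List (Fin n)) → z ∈ l → ¬ P z →
  AtLeast P (length l + k) → AtLeast (λ y → P y × y ∉ l) (suc k)
deleteAllButOne {k = k} {P = P} {z} (z ∷ l) (here refl) ¬pz c = mapAtLeast
  (λ (py , y∉l) → py , λ { (here refl) → ¬pz py ; (there y∈l) → y∉l y∈l })
  (deleteAll l (subst (AtLeast P) (sym (+-suc (length l) k)) c))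
deleteAllButOne (x ∷ l) (there z∈l) ¬pz c = mapAtLeast
  (λ ((py , y≢x) , y∉l) → py , λ { (here y≡x) → y≢x y≡x ; (there y∈l) → y∉l y∈l })
  (deleteAllButOne l z∈l (¬pz ∘ proj₁) (delete x c))

choose : {P : Fin n → Set} → AtLeast P k →
  Σ (Fin k → Fin n) λ g → (∀ i → P (g i)) × (∀ i j → g i ≡ g j → i ≡ j)
choose none = (λ ()) , (λ ()) , λ ()
choose {n = n} {P = P} (pick {k} x px rest) with choose rest
... | g , g∈ , g-inj = g′ , g′∈ , g′-inj
  where
  g′ : Fin (suc k) → Fin n
  g′ zero = x
  g′ (suc i) = g i
  g′∈ : ∀ i → P (g′ i)
  g′∈ zero = px
  g′∈ (suc i) = proj₁ (g∈ i)
  g′-inj : ∀ i j → g′ i ≡ g′ j → i ≡ j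
  g′-inj zero zero _ = refl
  g′-inj zero (suc j) e = ⊥-elim (proj₂ (g∈ j) (sym e))
  g′-inj (suc i) zero e = ⊥-elim (proj₂ (g∈ i) e)
  g′-inj (suc i) (suc j) e = cong suc (g-inj i j e)

-- Membership in `l` is kept in the predicate so that uniqueness separates the head from all later
-- witnesses.
sum⇒AtLeast : (P : Fin n → Bool) (l : List (Fin n)) → Unique l →
  k ≤ sum (map (λ y → if P y then 1 else 0) l) → AtLeast (λ y → P y ≡ true × y ∈ l) k
sum⇒AtLeast P [] _ z≤n = none
sum⇒AtLeast P (x ∷ l) (x∉l ∷ un) k≤ with P x in eq
... | false = mapAtLeast (λ (py , y∈l) → py , there y∈l) (sum⇒AtLeast P l un k≤)
sum⇒AtLeast {k = zero} P (x ∷ l) (x∉l ∷ un) k≤ | true = none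
sum⇒AtLeast {k = suc k} P (x ∷ l) (x∉l ∷ un) (s≤s k≤) | true = pick x (eq , here refl)
  (mapAtLeast (λ (py , y∈l) → (py , there y∈l) , λ y≡x → All.lookup x∉l y∈l (sym y≡x))
    (sum⇒AtLeast P l un k≤))

count⇒AtLeast : (P : Fin n → Bool) → k ≤ sum (map (λ y → if P y then 1 else 0) (allFin n)) →
  AtLeast (λ y → P y ≡ true) k
count⇒AtLeast {n = n} P k≤ = mapAtLeast proj₁ (sum⇒AtLeast P (allFin n) (allFin⁺ n) k≤)

-- Double stars from an arc and the neighbourhoods of its ends

data Dir : Set where
  out into : Dir

Nbr : Adj n → Dir → Fin n → Fin n → Set
Nbr A out x y = A x y ≡ true
Nbr A into x y = A y x ≡ true

-- Leaf directions at the tail and at the head of the central arc; the missing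
-- combination (into, out) is the one that is not among the three double stars.
data Compatible : Dir → Dir → Set where
  ods : Compatible out out
  ids : Compatible into into
  oids : Compatible out into

module DoubleStars {n : ℕ} (A : Adj n) (loopless : Loopless A) (r′ s′ : ℕ) where

  r s : ℕ
  r = suc r′
  s = suc s′

  Embedding : (DSV r s → DSV r s → Set) → (Fin n → Set) → Set
  Embedding Arc Q = Σ (DSV r s → Fin n) λ f →
    ((p q : DSV r s) → f p ≡ f q → p ≡ q) ×
    ((p q : DSV r s) → Arc p q → A (f p) (f q) ≡ true) ×
    (∀ p → Q (f p))

  data Copy (Q : Fin n → Set) : Set where
    ⟨_⟩ : Embedding ODSArc Q ⊎ Embedding IDSArc Q ⊎ Embedding OIDSArc Q → Copy Q

  Leaf : Dir → Fin n → Fin n → (Fin n → Set) → Fin n → Set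
  Leaf d x y Q z = (Nbr A d x z × Q z) × z ≢ y

  arc-≢ : ∀ {x y} → A x y ≡ true → x ≢ y
  arc-≢ {x} xy refl with trans (sym (loopless x)) xy
  ... | ()

  nbr-≢ : ∀ d {x y} → Nbr A d x y → y ≢ x
  nbr-≢ out xy y≡x = arc-≢ xy (sym y≡x)
  nbr-≢ into yx = arc-≢ yx

  copy : ∀ {d e Q x y} → Compatible d e → A x y ≡ true → Q x → Q y →
    (g : Fin r → Fin n) → (∀ i → Leaf d x y Q (g i)) → (∀ i j → g i ≡ g j → i ≡ j) →
    (h : Fin s → Fin n) → (∀ i → Leaf e y x Q (h i)) → (∀ i j → h i ≡ h j → i ≡ j) →
    (∀ i j → g i ≢ h j) → Copy Q
  copy {d} {e} {Q} {x} {y} comp xy qx qy g g-leaf g-inj h h-leaf h-inj g≢h = assemble comp g-leaf h-leaf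
    where
    f : DSV r s → Fin n
    f u = x
    f v = y
    f (a i) = g i
    f (b j) = h j
    g≢x : ∀ i → g i ≢ x
    g≢x i = nbr-≢ d (proj₁ (proj₁ (g-leaf i)))
    h≢y : ∀ i → h i ≢ y
    h≢y i = nbr-≢ e (proj₁ (proj₁ (h-leaf i)))
    f-inj : ∀ p q → f p ≡ f q → p ≡ q
    f-inj u u _ = refl
    f-inj u v eq = ⊥-elim (arc-≢ xy eq)
    f-inj u (a i) eq = ⊥-elim (g≢x i (sym eq))
    f-inj u (b j) eq = ⊥-elim (proj₂ (h-leaf j) (sym eq))
    f-inj v u eq = ⊥-elim (arc-≢ xy (sym eq))
    f-inj v v _ = refl
    f-inj v (a i) eq = ⊥-elim (proj₂ (g-leaf i) (sym eq))
    f-inj v (b j) eq = ⊥-elim (h≢y j (sym eq))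
    f-inj (a i) u eq = ⊥-elim (g≢x i eq)
    f-inj (a i) v eq = ⊥-elim (proj₂ (g-leaf i) eq)
    f-inj (a i) (a j) eq = cong a (g-inj i j eq)
    f-inj (a i) (b j) eq = ⊥-elim (g≢h i j eq)
    f-inj (b j) u eq = ⊥-elim (proj₂ (h-leaf j) eq)
    f-inj (b j) v eq = ⊥-elim (h≢y j eq)
    f-inj (b j) (a i) eq = ⊥-elim (g≢h i j (sym eq))
    f-inj (b i) (b j) eq = cong b (h-inj i j eq)
    f-in : ∀ p → Q (f p)
    f-in u = qx
    f-in v = qy
    f-in (a i) = proj₂ (proj₁ (g-leaf i))
    f-in (b j) = proj₂ (proj₁ (h-leaf j))
    assemble : ∀ {d e} → Compatible d e → (∀ i → Leaf d x y Q (g i)) →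
      (∀ i → Leaf e y x Q (h i)) → Copy Q
    assemble ods gl hl = ⟨ inj₁ (f , f-inj ,
      (λ { _ _ uv → xy ; _ _ (ua i) → proj₁ (proj₁ (gl i)) ; _ _ (vb j) → proj₁ (proj₁ (hl j)) }) , f-in) ⟩
    assemble ids gl hl = ⟨ inj₂ (inj₁ (f , f-inj ,
      (λ { _ _ uv → xy ; _ _ (au i) → proj₁ (proj₁ (gl i)) ; _ _ (bv j) → proj₁ (proj₁ (hl j)) }) , f-in)) ⟩
    assemble oids gl hl = ⟨ inj₂ (inj₂ (f , f-inj ,
      (λ { _ _ uv → xy ; _ _ (ua i) → proj₁ (proj₁ (gl i)) ; _ _ (bv j) → proj₁ (proj₁ (hl j)) }) , f-in)) ⟩

  -- The `s` leaves at the head are chosen first; they block at most `s` of the `r + s` candidates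
  -- at the tail.
  copy-tailRich : ∀ {d e Q x y} → Compatible d e → A x y ≡ true → Q x → Q y →
    AtLeast (Leaf d x y Q) (r + s) → AtLeast (Leaf e y x Q) s → Copy Q
  copy-tailRich {d} {x = x} {y} comp xy qx qy cx cy with choose cy
  ... | h , h-leaf , h-inj
    with choose (deleteAll (tabulate h) (subst (AtLeast (Leaf d x y _))
           (trans (+-comm r s) (cong (_+ r) (sym (length-tabulate h)))) cx))
  ... | g , g-leaf , g-inj = copy comp xy qx qy g (proj₁ ∘ g-leaf) g-inj h h-leaf h-inj
    λ i j gi≡hj → proj₂ (g-leaf i) (subst (_∈ tabulate h) (sym gi≡hj) (∈-tabulate⁺ {f = h} j))

  copy-headRich : ∀ {d e Q x y} → Compatible d e → A x y ≡ true → Q x → Q y →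
    AtLeast (Leaf d x y Q) r → AtLeast (Leaf e y x Q) (r + s) → Copy Q
  copy-headRich {e = e} {x = x} {y} comp xy qx qy cx cy with choose cx
  ... | g , g-leaf , g-inj
    with choose (deleteAll (tabulate g) (subst (AtLeast (Leaf e y x _))
           (cong (_+ s) (sym (length-tabulate g))) cy))
  ... | h , h-leaf , h-inj = copy comp xy qx qy g g-leaf g-inj h (proj₁ ∘ h-leaf) h-inj
    λ i j gi≡hj → proj₂ (h-leaf j) (subst (_∈ tabulate g) gi≡hj (∈-tabulate⁺ {f = g} i))

  Degree : Dir → (Fin n → Set) → Fin n → ℕ → Set
  Degree d Q x k = AtLeast (λ y → Nbr A d x y × Q y) k

  -- Removing the opposite end costs each side at most one candidate: `r + s` remain at the tail,
  -- and `r + s - 1`, hence at least `s`, at the head.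
  copy-richTail : ∀ {d e Q x y} → Compatible d e → A x y ≡ true → Q x → Q y →
    Degree d Q x (1 + (r + s)) → Degree e Q y (r + s) → Copy Q
  copy-richTail {x = x} {y} comp xy qx qy cx cy = copy-tailRich comp xy qx qy (delete y cx)
    (weaken (m≤n+m s r′) (delete x cy))

  copy-richHead : ∀ {d e Q x y} → Compatible d e → A x y ≡ true → Q x → Q y →
    Degree d Q x (r + s) → Degree e Q y (1 + (r + s)) → Copy Q
  copy-richHead {x = x} {y} comp xy qx qy cx cy = copy-headRich comp xy qx qy
    (weaken (≤-trans (s≤s (m≤m+n r′ s′)) (≤-reflexive (sym (+-suc r′ s′)))) (delete y cx))
    (delete x cy)

  -- The rich vertex `x` is the tail if `d` is `out` and the head if `d` is `into`, so the excluded
  -- pair never arises, whatever the direction at `y`.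
  copy-labelled : ∀ d {Q x y} → Nbr A d x y → Q x → Q y → Degree d Q x (1 + (r + s)) →
    (∃ λ e → Degree e Q y (r + s)) → Copy Q
  copy-labelled out xy qx qy cx (out , cy) = copy-richTail ods xy qx qy cx cy
  copy-labelled out xy qx qy cx (into , cy) = copy-richTail oids xy qx qy cx cy
  copy-labelled into yx qx qy cx (out , cy) = copy-richHead oids yx qy qx cy cx
  copy-labelled into yx qx qy cx (into , cy) = copy-richHead ids yx qy qx cy cx

  copy-complete : ∀ {P : Fin n → Set} → (∀ x y → P x → P y → x ≢ y → A x y ≡ true) →
    AtLeast P (2 + (r + s)) → Copy P
  copy-complete {P} complete c with member c
  ... | x , px with member (delete x c)
  ... | y , py , y≢x = copy-richTail ods (complete x y px py (y≢x ∘ sym)) px py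
          (all x px) (weaken (m≤n⇒m≤1+n ≤-refl) (all y py))
    where
    all : ∀ x → P x → Degree out P x (1 + (r + s))
    all x px = mapAtLeast (λ {z} (pz , z≢x) → complete x z px pz (z≢x ∘ sym) , pz) (delete x c)

  vertex : ∀ {Q} → Copy Q → DSV r s → Fin n
  vertex ⟨ inj₁ (f , _) ⟩ = f
  vertex ⟨ inj₂ (inj₁ (f , _)) ⟩ = f
  vertex ⟨ inj₂ (inj₂ (f , _)) ⟩ = f

  vertex-∈ : ∀ {Q} (c : Copy Q) p → Q (vertex c p)
  vertex-∈ ⟨ inj₁ (_ , _ , _ , q) ⟩ = q
  vertex-∈ ⟨ inj₂ (inj₁ (_ , _ , _ , q)) ⟩ = q
  vertex-∈ ⟨ inj₂ (inj₂ (_ , _ , _ , q)) ⟩ = q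

  relocate : ∀ {Q R} (c : Copy Q) → (∀ p → R (vertex c p)) → Copy R
  relocate ⟨ inj₁ (f , i , t , _) ⟩ q = ⟨ inj₁ (f , i , t , q) ⟩
  relocate ⟨ inj₂ (inj₁ (f , i , t , _)) ⟩ q = ⟨ inj₂ (inj₁ (f , i , t , q)) ⟩
  relocate ⟨ inj₂ (inj₂ (f , i , t , _)) ⟩ q = ⟨ inj₂ (inj₂ (f , i , t , q)) ⟩

  image : (DSV r s → Fin n) → List (Fin n)
  image f = f u ∷ f v ∷ tabulate (f ∘ a) ++ tabulate (f ∘ b)

  ∈-image : ∀ f p → f p ∈ image f
  ∈-image f u = here refl
  ∈-image f v = there (here refl)
  ∈-image f (a i) = there (there (∈-++⁺ˡ (∈-tabulate⁺ {f = f ∘ a} i)))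
  ∈-image f (b j) = there (there (∈-++⁺ʳ (tabulate (f ∘ a)) (∈-tabulate⁺ {f = f ∘ b} j)))

  image-∈ : ∀ f {x} → x ∈ image f → ∃ λ p → f p ≡ x
  image-∈ f (here refl) = u , refl
  image-∈ f (there (here refl)) = v , refl
  image-∈ f (there (there x∈)) with ∈-++⁻ (tabulate (f ∘ a)) x∈
  ... | inj₁ x∈a with ∈-tabulate⁻ {f = f ∘ a} x∈a
  ...   | i , refl = a i , refl
  image-∈ f (there (there x∈)) | inj₂ x∈b with ∈-tabulate⁻ {f = f ∘ b} x∈b
  ...   | j , refl = b j , refl

  length-image : ∀ f → length (image f) ≡ 2 + (r + s)
  length-image f = cong (2 +_) (trans (length-++ (tabulate (f ∘ a)))
    (cong₂ _+_ (length-tabulate (f ∘ a)) (length-tabulate (f ∘ b))))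

-- Walks and enlarged vertex sets

module _ {A : Adj n} where

  _∙_ : ∀ {S x y z} → WalkIn A S x y → WalkIn A S y z → WalkIn A S x z
  here _ ∙ q = q
  step x∈S xy p ∙ q = step x∈S xy (p ∙ q)

  mapWalk : ∀ {S S′ x y} → (∀ {z} → S z → S′ z) → WalkIn A S x y → WalkIn A S′ x y
  mapWalk S⊆S′ (here x∈S) = here (S⊆S′ x∈S)
  mapWalk S⊆S′ (step x∈S xy p) = step (S⊆S′ x∈S) xy (mapWalk S⊆S′ p)

infixr 5 _⊕_

_⊕_ : List (Fin n) → Subset n → Subset n
l ⊕ B = foldr (λ x C → ⁅ x ⁆ ∪ C) B l

∈-⊕⁺ : ∀ {B : Subset n} l {x} → x ∈ l ⊎ x ∈ˢ B → x ∈ˢ l ⊕ B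
∈-⊕⁺ [] (inj₂ x∈B) = x∈B
∈-⊕⁺ (y ∷ l) (inj₁ (here refl)) = x∈p∪q⁺ (inj₁ (x∈⁅x⁆ y))
∈-⊕⁺ (y ∷ l) (inj₁ (there x∈l)) = x∈p∪q⁺ (inj₂ (∈-⊕⁺ l (inj₁ x∈l)))
∈-⊕⁺ (y ∷ l) (inj₂ x∈B) = x∈p∪q⁺ (inj₂ (∈-⊕⁺ l (inj₂ x∈B)))

∈-⊕⁻ : ∀ {B : Subset n} l {x} → x ∈ˢ l ⊕ B → x ∈ l ⊎ x ∈ˢ B
∈-⊕⁻ [] x∈B = inj₂ x∈B
∈-⊕⁻ {B = B} (y ∷ l) x∈ with x∈p∪q⁻ ⁅ y ⁆ (l ⊕ B) x∈
... | inj₁ x∈y = inj₁ (here (x∈⁅y⁆⇒x≡y y x∈y))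
... | inj₂ x∈C with ∈-⊕⁻ l x∈C
...   | inj₁ x∈l = inj₁ (there x∈l)
...   | inj₂ x∈B = inj₂ x∈B

Strong : Adj n → Subset n → Set
Strong A C = StronglyConnectedOn A (_∈ˢ C)

-- Shortest ears

module Ears {n : ℕ} (A : Adj n) (B : Subset n) where

  Enters Exits : Fin n → Set
  Enters x = ∃ λ c → c ∈ˢ B × A c x ≡ true
  Exits x = ∃ λ c → c ∈ˢ B × A x c ≡ true

  exits? : ∀ x → Dec (Exits x)
  exits? x = any? λ c → c ∈? B ×-dec (A x c Bool.≟ true)

  enters? : ∀ x → Dec (Enters x)
  enters? x = any? λ c → c ∈? B ×-dec (A c x Bool.≟ true)

  -- l lists the vertices of a walk that starts at x, stays outside B, and whose last
  -- vertex has an arc into B.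
  data Exit : Fin n → List (Fin n) → Set where
    last : ∀ {x} → x ∉ˢ B → Exits x → Exit x (x ∷ [])
    more : ∀ {x y l} → x ∉ˢ B → A x y ≡ true → Exit y l → Exit x (x ∷ l)

  exit-start : ∀ {x l} → Exit x l → x ∉ˢ B
  exit-start (last x∉B _) = x∉B
  exit-start (more x∉B _ _) = x∉B

  exit-suffix : ∀ {x y l} → Exit x l → y ∈ l → ∃ λ l′ → Exit y l′ × length l′ ≤ length l
  exit-suffix e@(last _ _) (here refl) = _ , e , ≤-refl
  exit-suffix e@(more _ _ _) (here refl) = _ , e , ≤-refl
  exit-suffix (more _ _ e) (there y∈l) with exit-suffix e y∈l
  ... | l′ , e′ , l′≤l = l′ , e′ , m≤n⇒m≤1+n l′≤l

  exit-tail : ∀ {x y l} → Exit x (x ∷ l) → y ∈ l → ∃ λ l′ → Exit y l′ × length l′ ≤ length l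
  exit-tail (last _ _) ()
  exit-tail (more _ _ e) = exit-suffix e

  exit-suffix-< : ∀ {x y l} → Exit x l → y ∈ l →
    y ≡ x ⊎ (∃ λ l′ → Exit y l′ × length l′ < length l)
  exit-suffix-< (last _ _) (here refl) = inj₁ refl
  exit-suffix-< (more _ _ _) (here refl) = inj₁ refl
  exit-suffix-< (more _ _ e) (there y∈l) with exit-suffix e y∈l
  ... | l′ , e′ , l′≤l = inj₂ (l′ , e′ , s≤s l′≤l)

  exit-next : ∀ {x l} → Exit x (x ∷ l) → l ≡ [] ⊎ (∃ λ y → Exit y l)
  exit-next (last _ _) = inj₁ refl
  exit-next (more _ _ e) = inj₂ (_ , e)

  -- Fixing the length turns the search for a walk into a finite recursion.
  exitOfLength? : ∀ k x → Dec (∃ λ l → Exit x l × length l ≡ k)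
  exitOfLength? zero x = no λ { (_ , last _ _ , ()) ; (_ , more _ _ _ , ()) }
  exitOfLength? (suc zero) x = map′
    (λ (x∉B , ex) → _ , last x∉B ex , refl)
    (λ { (_ , last x∉B ex , _) → x∉B , ex ; (_ , more _ _ (last _ _) , ()) ; (_ , more _ _ (more _ _ _) , ()) })
    (¬? (x ∈? B) ×-dec exits? x)
  exitOfLength? (suc (suc k)) x = map′
    (λ (x∉B , y , xy , l , e , eq) → _ , more x∉B xy e , cong suc eq)
    (λ { (_ , last _ _ , ()) ; (_ , more x∉B xy e , eq) → x∉B , _ , xy , _ , e , suc-injective eq })
    (¬? (x ∈? B) ×-dec any? λ y → (A x y Bool.≟ true) ×-dec exitOfLength? (suc k) y)

  -- Minimality ranges over walks, repeated vertices allowed, so a shortcut contradicts it without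
  -- any check of distinctness.
  NoShorterEar : ℕ → Set
  NoShorterEar k = ∀ {x l} → Enters x → Exit x l → k ≤ length l

  shortestEar : ∀ {x l} → Enters x → Exit x l →
    ∃ λ x → ∃ λ l → Enters x × Exit x l × NoShorterEar (length l)
  shortestEar {x} {l} en ex = go x l en ex (<-wellFounded (length l))
    where
    go : ∀ x l → Enters x → Exit x l → Acc _<_ (length l) →
      ∃ λ x → ∃ λ l → Enters x × Exit x l × NoShorterEar (length l)
    go x l en ex (acc rec) with any? {n = length l} (λ i → any? λ y → enters? y ×-dec exitOfLength? (toℕ i) y)
    ... | yes (i , y , en′ , l′ , ex′ , eq) =
      go y l′ en′ ex′ (rec (subst (_< length l) (sym eq) (toℕ<n i)))
    ... | no ¬shorter = x , l , en , ex , λ {y} {l′} en′ ex′ → ≮⇒≥ λ l′<l →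
      ¬shorter (fromℕ< l′<l , y , en′ , l′ , ex′ , sym (toℕ-fromℕ< l′<l))

  leave : ∀ {x y} → x ∈ˢ B → y ∉ˢ B → WalkIn A (λ _ → ⊤) x y →
    ∃ λ z → Enters z × z ∉ˢ B
  leave x∈B y∉B (here _) = ⊥-elim (y∉B x∈B)
  leave x∈B y∉B (step {y = z} _ xz p) with z ∈? B
  ... | yes z∈B = leave z∈B y∉B p
  ... | no z∉B = z , (_ , x∈B , xz) , z∉B

  return : ∀ {x y} → x ∉ˢ B → y ∈ˢ B → WalkIn A (λ _ → ⊤) x y → ∃ (Exit x)
  return x∉B y∈B (here _) = ⊥-elim (x∉B y∈B)
  return x∉B y∈B (step {y = z} _ xz p) with z ∈? B
  ... | yes z∈B = _ , last x∉B (z , z∈B , xz)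
  ... | no z∉B with return z∉B y∈B p
  ...   | l , e = _ , more x∉B xz e

  -- A walk from `h` to `y` must leave `B`; its first vertex outside has a walk back to `h`, cut off
  -- at its first arc into `B`.
  ear : ∀ {h y} → h ∈ˢ B → y ∉ˢ B → StronglyConnected A →
    ∃ λ x → ∃ λ l → Enters x × Exit x l × NoShorterEar (length l)
  ear {h} {y} h∈B y∉B strong with leave h∈B y∉B (strong h y tt tt)
  ... | x , en , x∉B = shortestEar en (proj₂ (return x∉B h∈B (strong x h tt tt)))

  module _ {S : Fin n → Set} (B⊆S : ∀ {x} → x ∈ˢ B → S x) where

    walkIn : ∀ {w x y l} → S w → A w x ≡ true → Exit x l → (∀ {z} → z ∈ l → S z) →
      y ∈ l → WalkIn A S w y
    walkIn w∈S wx (last _ _) l⊆S (here refl) = step w∈S wx (here (l⊆S (here refl)))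
    walkIn w∈S wx (more _ _ _) l⊆S (here refl) = step w∈S wx (here (l⊆S (here refl)))
    walkIn w∈S wx (more _ xy e) l⊆S (there y∈l) =
      step w∈S wx (walkIn (l⊆S (here refl)) xy e (l⊆S ∘ there) y∈l)

    walkOut : ∀ {x l} → Exit x l → (∀ {z} → z ∈ l → S z) → ∃ λ c → c ∈ˢ B × WalkIn A S x c
    walkOut (last _ (c , c∈B , xc)) l⊆S = c , c∈B , step (l⊆S (here refl)) xc (here (B⊆S c∈B))
    walkOut (more _ xy e) l⊆S with walkOut e (l⊆S ∘ there)
    ... | c , c∈B , p = c , c∈B , step (l⊆S (here refl)) xy p

    exitFrom : ∀ {x y l} → Exit x l → (∀ {z} → z ∈ l → S z) → y ∈ l →
      ∃ λ c → c ∈ˢ B × WalkIn A S y c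
    exitFrom e@(last _ _) l⊆S (here refl) = walkOut e l⊆S
    exitFrom e@(more _ _ _) l⊆S (here refl) = walkOut e l⊆S
    exitFrom (more _ _ e) l⊆S (there y∈l) = exitFrom e (l⊆S ∘ there) y∈l

  -- Inside the union every vertex reaches `B` along the rest of the ear and is reached from `B`
  -- along its start.
  addEar : ∀ {x l} → Strong A B → Enters x → Exit x l → Strong A (l ⊕ B)
  addEar {x} {l} strong (c , c∈B , cx) e y z y∈ z∈ with outOf (∈-⊕⁻ l y∈) | inTo (∈-⊕⁻ l z∈)
    where
    S : Fin n → Set
    S = _∈ˢ l ⊕ B
    B⊆S : ∀ {x} → x ∈ˢ B → S x
    B⊆S = ∈-⊕⁺ l ∘ inj₂
    l⊆S : ∀ {x} → x ∈ l → S x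
    l⊆S = ∈-⊕⁺ l ∘ inj₁
    outOf : ∀ {y} → y ∈ l ⊎ y ∈ˢ B → ∃ λ c → c ∈ˢ B × WalkIn A S y c
    outOf (inj₁ y∈l) = exitFrom B⊆S e l⊆S y∈l
    outOf (inj₂ y∈B) = _ , y∈B , here (B⊆S y∈B)
    inTo : ∀ {y} → y ∈ l ⊎ y ∈ˢ B → ∃ λ c → c ∈ˢ B × WalkIn A S c y
    inTo (inj₁ y∈l) = c , c∈B , walkIn B⊆S (B⊆S c∈B) cx e l⊆S y∈l
    inTo (inj₂ y∈B) = _ , y∈B , here (B⊆S y∈B)
  ... | c₁ , c₁∈B , p | c₂ , c₂∈B , q =
    p ∙ (mapWalk (∈-⊕⁺ l ∘ inj₂) (strong c₁ c₂ c₁∈B c₂∈B) ∙ q)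

-- With `r = i + 1` and `s = j + 1`, a supply of `r + s - 2` leaves suffices for `s` or for `r`,
-- except when `r = s = 1`.
compare : ∀ i j → suc j ≤ i + j ⊎ suc i ≤ i + j ⊎ (i ≡ 0 × j ≡ 0)
compare (suc i) j = inj₁ (s≤s (m≤n+m j i))
compare zero (suc j) = inj₂ (inj₁ (s≤s z≤n))
compare zero zero = inj₂ (inj₂ (refl , refl))

-- Enlarging a strong set by a shortest ear

module Growth {n : ℕ} (A : Adj n) (loopless : Loopless A) (r′ s′ : ℕ)
  (degree : ∀ d x → AtLeast (Nbr A d x) (3 + (suc r′ + suc s′)))
  (B : Subset n) (strong : Strong A B) where

  open DoubleStars A loopless r′ s′
  open Ears A B
  open DecMembership (_≟_ {n}) using () renaming (_∈?_ to _∈ˡ?_)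

  Progress : Set
  Progress = ∃ λ C → B ⊂ C × Strong A C × Copy (_∉ˢ C)

  Rest : List (Fin n) → Fin n → Set
  Rest l x = x ∉ˢ B × x ∉ l

  rest? : ∀ l x → Dec (Rest l x)
  rest? l x = ¬? (x ∈? B) ×-dec ¬? (x ∈ˡ? l)

  progress : ∀ {x l} → Enters x → Exit x l → Copy (Rest l) → Progress
  progress {x} {l} en e c = l ⊕ B ,
    (∈-⊕⁺ l ∘ inj₂ , x , ∈-⊕⁺ l (inj₁ (start e)) , exit-start e) ,
    addEar strong en e ,
    relocate c λ p x∈ → [ proj₂ (vertex-∈ c p) , proj₁ (vertex-∈ c p) ]′ (∈-⊕⁻ l x∈)
    where
    start : ∀ {x l} → Exit x l → x ∈ l
    start (last _ _) = here refl
    start (more _ _ _) = here refl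

  -- The direction names the neighbours that then all lie outside `B`.
  Detached : Dir → Fin n → Set
  Detached out x = ¬ Exits x
  Detached into x = ¬ Enters x

  detached : ∀ {x} → ¬ (Enters x × Exits x) → ∃ λ d → Detached d x
  detached {x} ¬both with exits? x
  ... | yes ex = into , λ en → ¬both (en , ex)
  ... | no ¬ex = out , ¬ex

  nbr-∉ : ∀ d {x y} → Detached d x → Nbr A d x y → y ∉ˢ B
  nbr-∉ out ¬ex xy y∈B = ¬ex (_ , y∈B , xy)
  nbr-∉ into ¬en yx y∈B = ¬en (_ , y∈B , yx)

  -- `l₀` lists the ear vertices that can be neighbours of `x` in direction `d`; only these are
  -- subtracted from the degree m + 1.
  degreeInRest : ∀ d {x k} l l₀ → Detached d x → (∀ {y} → Nbr A d x y → y ∈ l → y ∈ l₀) →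
    3 + (r + s) ≡ length l₀ + k → Degree d (Rest l) x k
  degreeInRest d {x} l l₀ det cover eq = mapAtLeast
    (λ (xy , y∉l₀) → xy , nbr-∉ d det xy , y∉l₀ ∘ cover xy)
    (deleteAll l₀ (subst (AtLeast _) eq (degree d x)))

  degreeInRestButOne : ∀ d {x z k} l l₀ → Detached d x →
    (∀ {y} → Nbr A d x y → y ∈ l → y ∈ l₀) → z ∈ l₀ → ¬ Nbr A d x z →
    3 + (r + s) ≡ length l₀ + k → Degree d (Rest l) x (suc k)
  degreeInRestButOne d {x} l l₀ det cover z∈l₀ ¬xz eq = mapAtLeast
    (λ (xy , y∉l₀) → xy , nbr-∉ d det xy , y∉l₀ ∘ cover xy)
    (deleteAllButOne l₀ z∈l₀ ¬xz (subst (AtLeast _) eq (degree d x)))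

  -- A vertex off `B` and T with arcs from and to `B` is itself an ear, and T survives. Otherwise
  -- all vertices off both are detached, the ear vertex `x` lies in T, and a new star is centred on
  -- `w` and a neighbour.
  shortEar₁ : ∀ {x w} → Enters x → Exit x (x ∷ []) → (c : Copy (_∉ˢ B)) → w ∉ˢ B →
    w ∉ image (vertex c) → Progress
  shortEar₁ {x} {w} en e@(last x∉B ex) c w∉B w∉T
    with any? (λ y → ¬? (y ∈? B) ×-dec ¬? (y ∈ˡ? image (vertex c)) ×-dec enters? y ×-dec exits? y)
  ... | yes (y , y∉B , y∉T , en′ , ex′) = progress en′ (last y∉B ex′)
    (relocate c λ p → vertex-∈ c p , λ { (here eq) → y∉T (subst (_∈ _) eq (∈-image (vertex c) p)) })
  ... | no ¬free with detached {w} (λ (en′ , ex′) → ¬free (w , w∉B , w∉T , en′ , ex′))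
  ... | d , det
    -- The degree m + 1 exceeds the size m of T, so a neighbour off T exists.
    with member (deleteAll (image (vertex c)) (subst (AtLeast _)
           (trans (+-comm 1 _) (cong (_+ 1) (sym (length-image (vertex c))))) (degree d w)))
  ... | y , wy , y∉T with nbr-∉ d det wy
  ... | y∉B with detached {y} (λ (en′ , ex′) → ¬free (y , y∉B , y∉T , en′ , ex′))
  ... | d′ , det′ = progress en e (copy-labelled d wy (inRest w∉B w∉T) (inRest y∉B y∉T)
    (weaken (n≤1+n _) (degreeInRest d l l det (λ _ → id) refl))
    (d′ , weaken (m≤n⇒m≤1+n (n≤1+n _)) (degreeInRest d′ l l det′ (λ _ → id) refl)))
    where
    l : List (Fin n)
    l = x ∷ []
    inRest : ∀ {z} → z ∉ˢ B → z ∉ image (vertex c) → Rest l z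
    inRest z∉B z∉T = z∉B , λ { (here refl) → ¬free (x , z∉B , z∉T , en , ex) }

  shortEar₂ : ∀ {x y} → NoShorterEar 2 → Enters x → Exit x (x ∷ y ∷ []) → Progress
  shortEar₂ {x} {y} min en e = progress en e found
    where
    l : List (Fin n)
    l = x ∷ y ∷ []
    label : ∀ {z} → z ∉ˢ B → ∃ λ d → Detached d z
    label z∉B = detached λ (en′ , ex′) → <-irrefl refl (min en′ (last z∉B ex′))
    labelDegree : ∀ {d z} → Detached d z → Degree d (Rest l) z (1 + (r + s))
    labelDegree {d} det = degreeInRest d l l det (λ _ → id) refl
    found : Copy (Rest l)
    -- `x` only supplies a vertex `z` of `Rest l`; the central arc joins `z` and `z′`.
    found with member (labelDegree {out} {x} (λ ex → <-irrefl refl (min en (last (exit-start e) ex))))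
    ... | z , _ , z∈ with label (proj₁ z∈)
    ...   | d , det with member (labelDegree {d} det)
    ...     | z′ , zz′ , z′∈ with label (proj₁ z′∈)
    ...       | d′ , det′ = copy-labelled d zz′ z∈ z′∈ (labelDegree {d} det)
      (d′ , weaken (n≤1+n _) (labelDegree {d′} det′))

  -- Ears with at least three vertices

  module LongEar {x₁ x₂ x₃ : Fin n} {t : List (Fin n)} (min : NoShorterEar (3 + length t))
    (en : Enters x₁) (x₁∉B : x₁ ∉ˢ B) (x₁x₂ : A x₁ x₂ ≡ true) (x₂∉B : x₂ ∉ˢ B)
    (x₂x₃ : A x₂ x₃ ≡ true) (e₃ : Exit x₃ (x₃ ∷ t)) where

    l : List (Fin n)
    l = x₁ ∷ x₂ ∷ x₃ ∷ t

    toRest : Copy (Rest l) → Progress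
    toRest = progress en (more x₁∉B x₁x₂ (more x₂∉B x₂x₃ e₃))

    ¬exits₁ : ¬ Exits x₁
    ¬exits₁ ex with min en (last x₁∉B ex)
    ... | s≤s ()

    level₂∉B : ∀ {w} → A x₁ w ≡ true → w ∉ˢ B
    level₂∉B = nbr-∉ out ¬exits₁

    ¬exits₂ : ∀ {w} → A x₁ w ≡ true → ¬ Exits w
    ¬exits₂ x₁w ex with min en (more x₁∉B x₁w (last (level₂∉B x₁w) ex))
    ... | s≤s (s≤s ())

    -- Jumping from `x₁` to `x₃` or beyond would give a shorter ear.
    noSkip₁ : ∀ {y} → A x₁ y ≡ true → y ∉ x₃ ∷ t
    noSkip₁ x₁y y∈ with exit-suffix e₃ y∈
    ... | l′ , e , l′≤ = <-irrefl refl (≤-trans (min en (more x₁∉B x₁y e)) (s≤s l′≤))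

    noSkip₂ : ∀ {w y} → A x₁ w ≡ true → A w y ≡ true → y ∉ t
    noSkip₂ x₁w wy y∈ with exit-tail e₃ y∈
    ... | l′ , e , l′≤ = <-irrefl refl
      (≤-trans (min en (more x₁∉B x₁w (more (level₂∉B x₁w) wy e))) (s≤s (s≤s l′≤)))

    cover₁ : ∀ {y} → A x₁ y ≡ true → y ∈ l → y ∈ x₂ ∷ []
    cover₁ x₁y (here refl) = ⊥-elim (arc-≢ x₁y refl)
    cover₁ x₁y (there (here y≡x₂)) = here y≡x₂
    cover₁ x₁y (there (there y∈)) = ⊥-elim (noSkip₁ x₁y y∈)

    cover₂ : ∀ {w y} → A x₁ w ≡ true → A w y ≡ true → y ∈ l → y ∈ x₁ ∷ x₂ ∷ x₃ ∷ []
    cover₂ x₁w wy (here eq) = here eq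
    cover₂ x₁w wy (there (here eq)) = there (here eq)
    cover₂ x₁w wy (there (there (here eq))) = there (there (here eq))
    cover₂ x₁w wy (there (there (there y∈t))) = ⊥-elim (noSkip₂ x₁w wy y∈t)

    module Rich {w : Fin n} (x₁w : A x₁ w ≡ true) (w∈ : Rest l w)
      (rich : Degree out (Rest l) w (1 + (r + s))) where

      attach : ∀ {e x} → Compatible out e → A w x ≡ true → Rest l x →
        Degree e (Rest l) x (r + s) → Progress
      attach comp wx x∈ c = toRest (copy-richTail comp wx w∈ x∈ rich c)

      -- The second alternative records the case left open: `x` sends arcs to all of `x₁`, ...,
      -- `x₄`, and `r = s = 1`, so that too few leaves may remain at `x`.
      level₃ : ∀ {x} → A w x ≡ true → Rest l x →
        Progress ⊎ (∃ λ x₄ → Exit x₄ t ×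
          (∀ {z} → z ∈ x₁ ∷ x₂ ∷ x₃ ∷ x₄ ∷ [] → A x z ≡ true) × r′ ≡ 0 × s′ ≡ 0)
      level₃ {x} wx x∈ with exits? x
      -- An exit at `x` makes `x₁`, `w`, `x` an ear, so `t` is empty and only three ear vertices are
      -- subtracted.
      ... | yes ex = inj₁ (attach oids wx x∈
        (degreeInRest into l l ¬en (λ _ → id) (cong (λ i → 3 + (i + (r + s))) (sym |t|≡0))))
        where
        ¬en : ¬ Enters x
        ¬en en′ with min en′ (last (proj₁ x∈) ex)
        ... | s≤s ()
        |t|≡0 : length t ≡ 0
        |t|≡0 = n≤0⇒n≡0 (≤-pred (≤-pred (≤-pred
          (min en (more x₁∉B x₁w (more (proj₁ w∈) wx (last (proj₁ x∈) ex)))))))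
      ... | no ¬ex with exit-next e₃
      ...   | inj₁ t≡[] = inj₁ (attach ods wx x∈ (degreeInRest out l l ¬ex (λ _ → id)
        (cong (λ l → 3 + (length l + (r + s))) (sym t≡[]))))
      ...   | inj₂ (x₄ , e₄) = thirdLevel
        where
        l₀ : List (Fin n)
        l₀ = x₁ ∷ x₂ ∷ x₃ ∷ x₄ ∷ []
        cover₃ : ∀ {y} → A x y ≡ true → y ∈ l → y ∈ l₀
        cover₃ xy (here eq) = here eq
        cover₃ xy (there (here eq)) = there (here eq)
        cover₃ xy (there (there (here eq))) = there (there (here eq))
        cover₃ xy (there (there (there y∈t))) with exit-suffix-< e₄ y∈t
        ... | inj₁ eq = there (there (there (here eq)))
        ... | inj₂ (l′ , e , l′<) = ⊥-elim (<-irrefl refl (≤-trans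
          (min en (more x₁∉B x₁w (more (proj₁ w∈) wx (more (proj₁ x∈) xy e))))
          (s≤s (s≤s l′<))))
        -- Four ear vertices are subtracted: m + 1 - 4 is `r′ + s`, one short of what `attach` asks
        -- for.
        degree-x : Degree out (Rest l) x (r′ + s)
        degree-x = degreeInRest out l l₀ ¬ex cover₃ refl
        leaves-w : AtLeast (Leaf out w x (Rest l)) (r + s)
        leaves-w = delete x rich
        thirdLevel : Progress ⊎ (∃ λ x₄ → Exit x₄ t ×
          (∀ {z} → z ∈ x₁ ∷ x₂ ∷ x₃ ∷ x₄ ∷ [] → A x z ≡ true) × r′ ≡ 0 × s′ ≡ 0)
        thirdLevel with any? (λ z → z ∈ˡ? l₀ ×-dec ¬? (A x z Bool.≟ true))
        -- A missing arc from `x` to one of the four supplies the unit that was short.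
        ... | yes (z , z∈ , ¬xz) = inj₁ (attach ods wx x∈
          (degreeInRestButOne out l l₀ ¬ex cover₃ z∈ ¬xz refl))
        ... | no full with A x w Bool.≟ true
        ...   | no ¬xw = inj₁ (toRest (copy-tailRich ods wx w∈ x∈ leaves-w (mapAtLeast
          (λ (xz , z∈) → (xz , z∈) , λ { refl → ¬xw xz }) (weaken (m≤n+m s r′) degree-x))))
        -- With arcs both ways, `r′ + s′` leaves remain at `x` besides `w`, and `x` may be the head
        -- of `wx` or the tail of `xw`.
        ...   | yes xw with delete w (subst (Degree out (Rest l) x) (+-suc r′ s′) degree-x)
                         | compare r′ s′
        ...     | leaves-x | inj₁ s≤ = inj₁ (toRest
          (copy-tailRich ods wx w∈ x∈ leaves-w (weaken s≤ leaves-x)))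
        ...     | leaves-x | inj₂ (inj₁ r≤) = inj₁ (toRest
          (copy-headRich ods xw x∈ w∈ (weaken r≤ leaves-x) leaves-w))
        ...     | leaves-x | inj₂ (inj₂ (r′≡0 , s′≡0)) = inj₂ (x₄ , e₄ ,
          (λ {z} z∈ → decidable-stable (A x z Bool.≟ true) λ ¬xz → full (z , z∈ , ¬xz)) ,
          r′≡0 , s′≡0)

      -- For r = s = 1 the vertices x, y, z below may have no out-neighbour in Rest l other
      -- than w. Rerouting the ear through w and x frees x₂ and x₃, and the copy is
      -- x₃ ← y → x₂ → c or x₃ ← z → x₂ → c.
      reroute : ∀ {x y z x₄} → A w x ≡ true → Rest l x →
        A w y ≡ true → Rest l y → y ≢ x → A w z ≡ true → Rest l z → z ≢ x → z ≢ y →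
        Exit x₄ t → A x x₄ ≡ true → (∀ {q} → q ∈ x₂ ∷ x₃ ∷ [] → A y q ≡ true) →
        (∀ {q} → q ∈ x₂ ∷ x₃ ∷ [] → A z q ≡ true) → r′ ≡ 0 → s′ ≡ 0 → Progress
      reroute {x} {y} {z} wx x∈ wy y∈ y≢x wz z∈ z≢x z≢y e₄ xx₄ y→ z→ r′≡0 s′≡0 =
        progress en (more x₁∉B x₁w (more (proj₁ w∈) wx (more (proj₁ x∈) xx₄ e₄))) found
        where
        l′ : List (Fin n)
        l′ = x₁ ∷ w ∷ x ∷ t
        stays : ∀ {q} → A w q ≡ true → Rest l q → q ≢ x → Rest l′ q
        stays wq (q∉B , q∉l) q≢x = q∉B , λ
          { (here eq) → q∉l (here eq)
          ; (there (here eq)) → arc-≢ wq (sym eq)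
          ; (there (there (here eq))) → q≢x eq
          ; (there (there (there q∈t))) → q∉l (there (there (there q∈t))) }
        x₂∈ : Rest l′ x₂
        x₂∈ = x₂∉B , λ
          { (here eq) → arc-≢ x₁x₂ (sym eq)
          ; (there (here refl)) → proj₂ w∈ (there (here refl))
          ; (there (there (here refl))) → proj₂ x∈ (there (here refl))
          ; (there (there (there x₂∈t))) → noSkip₁ x₁x₂ (there x₂∈t) }
        x₃≢x₁ : x₃ ≢ x₁
        x₃≢x₁ x₃≡x₁ = <-irrefl refl (≤-trans (min (subst Enters (sym x₃≡x₁) en) e₃)
          (n≤1+n _))
        x₃∈ : Rest l′ x₃
        x₃∈ = exit-start e₃ , λ
          { (here eq) → x₃≢x₁ eq
          ; (there (here refl)) → proj₂ w∈ (there (there (here refl)))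
          ; (there (there (here refl))) → proj₂ x∈ (there (there (here refl)))
          ; (there (there (there x₃∈t))) → noSkip₂ x₁x₂ x₂x₃ x₃∈t }
        cover : ∀ {q} → A x₂ q ≡ true → q ∈ l′ → q ∈ x₁ ∷ w ∷ x ∷ []
        cover x₂q (here eq) = here eq
        cover x₂q (there (here eq)) = there (here eq)
        cover x₂q (there (there (here eq))) = there (there (here eq))
        cover x₂q (there (there (there q∈t))) = ⊥-elim (noSkip₂ x₁x₂ x₂q q∈t)
        build : ∀ {y c} → A y x₂ ≡ true → A y x₃ ≡ true → Rest l′ y →
          A x₂ c ≡ true → Rest l′ c → c ≢ x₃ → c ≢ y → Copy (Rest l′)
        build {y} {c} yx₂ yx₃ y∈ x₂c c∈ c≢x₃ c≢y
          -- As `r` and `s` are 1, one witness each is enough; the added equations pin the leaves to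
          -- `x₃` and `c`, which makes them distinct.
          with choose (subst (AtLeast λ q → Leaf out y x₂ (Rest l′) q × q ≡ x₃) (cong suc (sym r′≡0))
                 (pick x₃ (((yx₃ , x₃∈) , arc-≢ x₂x₃ ∘ sym) , refl) none))
             | choose (subst (AtLeast λ q → Leaf out x₂ y (Rest l′) q × q ≡ c) (cong suc (sym s′≡0))
                 (pick c (((x₂c , c∈) , c≢y) , refl) none))
        ... | g , g∈ , g-inj | h , h∈ , h-inj =
          copy ods yx₂ y∈ x₂∈ g (proj₁ ∘ g∈) g-inj h (proj₁ ∘ h∈) h-inj
            λ i j eq → c≢x₃ (trans (sym (proj₂ (h∈ j))) (trans (sym eq) (proj₂ (g∈ i))))
        found : Copy (Rest l′)
        -- `x₂` meets the new ear in at most three vertices, so it keeps at least `r + s = 2`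
        -- out-neighbours, one of them other than `x₃`.
        found with member (subst (AtLeast _) (+-suc r′ s′) (delete x₃
                     (degreeInRest out l′ (x₁ ∷ w ∷ x ∷ []) (¬exits₂ x₁x₂) cover refl)))
        ... | c , (x₂c , c∈) , c≢x₃ with c ≟ y
        ...   | no c≢y = build (y→ (here refl)) (y→ (there (here refl))) (stays wy y∈ y≢x) x₂c c∈ c≢x₃ c≢y
        ...   | yes refl = build (z→ (here refl)) (z→ (there (here refl))) (stays wz z∈ z≢x) x₂c c∈ c≢x₃ (z≢y ∘ sym)

      -- Since `1 + (r + s)` is at least 3, `w` has three out-neighbours to try. If all are
      -- exceptional, one goes on the rerouted ear and the other two are candidate tails.
      rich-progress : Progress
      rich-progress with member rich
      ... | x , wx , x∈ with member (delete x rich)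
      ... | y , (wy , y∈) , y≢x with member (subst (AtLeast _) (+-suc r′ s′) (delete y (delete x rich)))
      ... | z , ((wz , z∈) , z≢x) , z≢y with level₃ wx x∈ | level₃ wy y∈ | level₃ wz z∈
      ... | inj₁ pr | _ | _ = pr
      ... | inj₂ _ | inj₁ pr | _ = pr
      ... | inj₂ _ | inj₂ _ | inj₁ pr = pr
      ... | inj₂ (x₄ , e₄ , x→ , r′≡0 , s′≡0) | inj₂ (_ , _ , y→ , _) | inj₂ (_ , _ , z→ , _) =
        reroute wx x∈ wy y∈ y≢x wz z∈ z≢x z≢y e₄ (x→ (there (there (there (here refl)))))
          (y→ ∘ widen) (z→ ∘ widen) r′≡0 s′≡0
        where
        widen : ∀ {q x₄} → q ∈ x₂ ∷ x₃ ∷ [] → q ∈ x₁ ∷ x₂ ∷ x₃ ∷ x₄ ∷ []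
        widen (here eq) = there (here eq)
        widen (there (here eq)) = there (there (here eq))

    level₂ : Fin n → Set
    level₂ w = A x₁ w ≡ true × Rest l w

    level₂? : ∀ w → Dec (level₂ w)
    level₂? w = (A x₁ w Bool.≟ true) ×-dec rest? l w

    level₂-size : AtLeast level₂ (2 + (r + s))
    level₂-size = degreeInRest out l (x₂ ∷ []) ¬exits₁ cover₁ refl

  longEar : ∀ {x₁ x₂ x₃ t} → NoShorterEar (3 + length t) → Enters x₁ → x₁ ∉ˢ B →
    A x₁ x₂ ≡ true → x₂ ∉ˢ B → A x₂ x₃ ≡ true → Exit x₃ (x₃ ∷ t) → Progress
  longEar {x₁} {x₂} {x₃} {t} min en x₁∉B x₁x₂ x₂∉B x₂x₃ e₃ = go
    where
    open LongEar min en x₁∉B x₁x₂ x₂∉B x₂x₃ e₃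
    l₀ : List (Fin n)
    l₀ = x₁ ∷ x₂ ∷ x₃ ∷ []
    go : Progress
    -- A missing arc from `w` to one of `x₁`, `x₂`, `x₃` raises the count from `r + s` to
    -- `1 + (r + s)`, which makes `w` rich.
    go with any? (λ w → level₂? w ×-dec any? (λ z → z ∈ˡ? l₀ ×-dec ¬? (A w z Bool.≟ true)))
    ... | yes (w , (x₁w , w∈) , z , z∈ , ¬wz) = Rich.rich-progress x₁w w∈
      (degreeInRestButOne out l l₀ (¬exits₂ x₁w) (cover₂ x₁w) z∈ ¬wz refl)
    -- Every `q` here has an arc to `x₃` and can replace `x₂`; a `q` that is no out-neighbour of `w`
    -- then lies on the ear and saves one.
    ... | no full with any? (λ w → level₂? w ×-dec any? (λ q → level₂? q ×-dec
       ¬? (w ≟ q) ×-dec ¬? (A w q Bool.≟ true)))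
    ...   | yes (w , (x₁w , w∈) , q , (x₁q , q∈) , w≢q , ¬wq) =
      Through-q.Rich.rich-progress x₁w w∈′
        (degreeInRestButOne out l′ (x₁ ∷ q ∷ x₃ ∷ []) (¬exits₂ x₁w) (Through-q.cover₂ x₁w)
          (there (here refl)) ¬wq refl)
      where
      l′ : List (Fin n)
      l′ = x₁ ∷ q ∷ x₃ ∷ t
      qx₃ : A q x₃ ≡ true
      qx₃ = decidable-stable (A q x₃ Bool.≟ true) λ ¬qx₃ →
        full (q , (x₁q , q∈) , x₃ , there (there (here refl)) , ¬qx₃)
      module Through-q = LongEar min en x₁∉B x₁q (proj₁ q∈) qx₃ e₃
      w∈′ : Rest l′ w
      w∈′ = proj₁ w∈ , λ
        { (here eq) → proj₂ w∈ (here eq)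
        ; (there (here eq)) → w≢q eq
        ; (there (there w∈t)) → proj₂ w∈ (there (there w∈t)) }
    ...   | no complete = toRest (relocate found λ p → proj₂ (vertex-∈ found p))
      where
      found : Copy level₂
      found = copy-complete
        (λ w q w∈ q∈ w≢q → decidable-stable (A w q Bool.≟ true) λ ¬wq →
          complete (w , w∈ , q , q∈ , w≢q , ¬wq))
        level₂-size

  grow : StronglyConnected A → ∀ {h w} → h ∈ˢ B → (c : Copy (_∉ˢ B)) → w ∉ˢ B →
    w ∉ image (vertex c) → Progress
  grow sc h∈B c w∉B w∉T with ear h∈B w∉B sc
  ... | _ , _ , en , e@(last _ _) , min = shortEar₁ en e c w∉B w∉T
  ... | _ , _ , en , e@(more _ _ (last _ _)) , min = shortEar₂ min en e
  -- Splitting `e₃` only exposes `x₃` as the head of its list of vertices.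
  ... | _ , _ , en , more x₁∉B x₁x₂ (more x₂∉B x₂x₃ e₃@(last _ _)) , min =
    longEar min en x₁∉B x₁x₂ x₂∉B x₂x₃ e₃
  ... | _ , _ , en , more x₁∉B x₁x₂ (more x₂∉B x₂x₃ e₃@(more _ _ _)) , min =
    longEar min en x₁∉B x₁x₂ x₂∉B x₂x₃ e₃

-- Iteration until the star is the whole complement

module Main {n : ℕ} (A : Adj n) (loopless : Loopless A) (sc : StronglyConnected A) (r′ s′ : ℕ)
  (degree : ∀ d x → AtLeast (Nbr A d x) (3 + (suc r′ + suc s′))) where

  open DoubleStars A loopless r′ s′

  Result : Set
  Result = CopyWithSCComplement {n} {r} {s} A ODSArc
    ⊎ CopyWithSCComplement {n} {r} {s} A IDSArc
    ⊎ CopyWithSCComplement {n} {r} {s} A OIDSArc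

  -- `B` is now exactly the complement of the star: `covered` gives one inclusion, and `c` avoids
  -- `B` by its type.
  complement : ∀ {B} → Strong A B → (c : Copy (_∉ˢ B)) →
    ¬ (∃ λ w → w ∉ˢ B × w ∉ image (vertex c)) →
    StronglyConnectedOn A (λ x → ∀ p → ¬ (vertex c p ≡ x))
  complement {B} strong c covered x y x∉T y∉T =
    mapWalk (λ { z∈B p refl → vertex-∈ c p z∈B }) (strong x y (inB x x∉T) (inB y y∉T))
    where
    inB : ∀ z → (∀ p → ¬ (vertex c p ≡ z)) → z ∈ˢ B
    inB z z∉T = decidable-stable (z ∈? B) λ z∉B →
      covered (z , z∉B , λ z∈T → let p , eq = image-∈ (vertex c) z∈T in z∉T p eq)

  fromCopy : ∀ {Q} (c : Copy Q) → StronglyConnectedOn A (λ x → ∀ p → ¬ (vertex c p ≡ x)) → Result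
  fromCopy ⟨ inj₁ (f , i , t , _) ⟩ conn = inj₁ (f , i , t , conn)
  fromCopy ⟨ inj₂ (inj₁ (f , i , t , _)) ⟩ conn = inj₂ (inj₁ (f , i , t , conn))
  fromCopy ⟨ inj₂ (inj₂ (f , i , t , _)) ⟩ conn = inj₂ (inj₂ (f , i , t , conn))

  iterate : ∀ {B h} → Acc _⊃_ B → h ∈ˢ B → Strong A B → Copy (_∉ˢ B) → Result
  iterate {B} (acc rec) h∈B strong c
    with any? (λ w → ¬? (w ∈? B) ×-dec ¬? (DecMembership._∈?_ _≟_ w (image (vertex c))))
  ... | no covered = fromCopy c (complement strong c covered)
  ... | yes (w , w∉B , w∉T) with Growth.grow A loopless r′ s′ degree B strong sc h∈B c w∉B w∉T
  ...   | C , B⊂C , strong′ , c′ = iterate (rec B⊂C) (proj₁ B⊂C h∈B) strong′ c′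

  result : Fin n → Result
  result x = iterate (⊃-wellFounded ⁅ x ⁆) (x∈⁅x⁆ x) strong found
    where
    strong : Strong A ⁅ x ⁆
    strong y z y∈ z∈ with x∈⁅y⁆⇒x≡y x y∈ | x∈⁅y⁆⇒x≡y x z∈
    ... | refl | refl = here (x∈⁅x⁆ x)
    avoiding : ∀ y → Degree out (_∉ˢ ⁅ x ⁆) y (2 + (r + s))
    avoiding y = mapAtLeast (λ (yz , z≢x) → yz , z≢x ∘ x∈⁅y⁆⇒x≡y x) (delete x (degree out y))
    found : Copy (_∉ˢ ⁅ x ⁆)
    found with member (avoiding x)
    ... | y , _ , y∉ with member (avoiding y)
    ...   | z , yz , z∉ = copy-labelled out yz y∉ z∉ (weaken (n≤1+n _) (avoiding y))
      (out , weaken (m≤n⇒m≤1+n (n≤1+n _)) (avoiding z))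

theorem4p4 : (m r s : ℕ) → 1 ≤ r → r ≤ m ∸ 3 → 1 ≤ s → s ≤ m ∸ 3 → r + s ≡ m ∸ 2 →
    (n : ℕ) → 0 < n → (A : Adj n) → Loopless A → StronglyConnected A →
    MinSemiDegreeAtLeast A (m + 1) →
    CopyWithSCComplement {n} {r} {s} A ODSArc
    ⊎ CopyWithSCComplement {n} {r} {s} A IDSArc
    ⊎ CopyWithSCComplement {n} {r} {s} A OIDSArc
theorem4p4 (suc (suc (suc m))) (suc r′) (suc s′) 1≤r r≤ 1≤s s≤ eq (suc n) 0<n A loopless sc δ =
  Main.result A loopless sc r′ s′ degree zero
  where
  -- The matched `m` is the original one minus 3, so `eq` reads `r + s = m + 1`.
  bound : 3 + (suc r′ + suc s′) ≡ suc (suc (suc m)) + 1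
  bound = cong (3 +_) (trans eq (+-comm 1 m))
  degree : ∀ d x → AtLeast (Nbr A d x) (3 + (suc r′ + suc s′))
  degree out x = count⇒AtLeast (A x) (≤-trans (≤-reflexive bound) (proj₁ (δ x)))
  degree into x = count⇒AtLeast (λ y → A y x) (≤-trans (≤-reflexive bound) (proj₂ (δ x)))
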